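{- Let $n\geq 3$ be an integer. (1) For $\ell=n-1$: $e_3(n,\ell,2)=\binom{n}{2}-\frac{n-1}{2}$ if $n$ is odd, and $e_3(n,\ell,2)=\binom{n}{2}-\frac{n-2}{2}$ if $n$ is even. (2) For $\ell=n-2$: $e_3(n,\ell,2)=\binom{n}{2}-\frac{n}{2}$ if $n$ is even, and $e_3(n,\ell,2)=\infty$ if $n$ is odd.
   Context: All graphs are undirected, finite and simple. For a graph $G$ and a nonempty set $S\subseteq V(G)$, the Steiner distance $d_G(S)$ is the minimum number of edges of a connected subgraph (equivalently, a subtree) of $G$ whose vertex set contains $S$; set $d_G(S)=\infty$ if there is none. The Steiner $3$-diameter is $sdiam_3(G)=\max\{d_G(S): S\subseteq V(G),\ |S|=3\}$. For natural numbers $n,\ell,d$ with $d<n$, $\ell<n$, let $\mathscr{H}_3(n,\ell,d)$ be the set of all graphs $G$ of order $n$ with maximum degree exactly $\ell$ and $sdiam_3(G)\leq d$. Put $e_3(n,\ell,d)=\min\{|E(G)|: G\in \mathscr{H}_3(n,\ell,d)\}$, with $e_3(n,\ell,d)=\infty$ if $\mathscr{H}_3(n,\ell,d)=\emptyset$. -}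

module Defs where

import Algebra.Properties.CommutativeMonoid.Sum as Sum
open import Data.Bool using (Bool; false; T; _∧_)
open import Data.Fin using (Fin; _<?_)
open import Data.Fin.Subset using (Subset; _∈_; _⊆_; ∣_∣)
open import Data.Nat using (ℕ; _≤_; _⊔_)
open import Data.Nat.Properties using (+-0-commutativeMonoid)
open import Data.Product using (Σ-syntax; ∃-syntax; _×_)
open import Data.Vec using (tabulate)
open import Data.Vec.Functional using (foldr)
open import Level using (0ℓ)
open import Relation.Binary using (Rel)
open import Relation.Binary.Construct.Add.Supremum.NonStrict _≤_ using (_≤⁺_)
open import Relation.Binary.Construct.Closure.ReflexiveTransitive using (Star)
open import Relation.Binary.PropositionalEquality using (_≡_)
open import Relation.Nullary using (¬_)
open import Relation.Nullary.Construct.Add.Supremum using (_⁺; [_]; ⊤⁺)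
open import Relation.Nullary.Decidable using (⌊_⌋)

open Sum +-0-commutativeMonoid using (sum)

-- ⊤⁺ is the value ∞.
ℕ∞ : Set
ℕ∞ = ℕ ⁺

-- "min P = x", with min ∅ = ∞.
IsMin : (ℕ → Set) → ℕ∞ → Set
IsMin P [ k ] = P k × (∀ m → P m → k ≤ m)
IsMin P ⊤⁺    = ∀ m → ¬ P m

-- "max P = x", for a nonempty set P of extended naturals.
IsMax : (ℕ∞ → Set) → ℕ∞ → Set
IsMax P x = P x × (∀ y → P y → y ≤⁺ x)

-- Finite simple graphs of order n, up to isomorphism: the vertex set is Fin n.
record Graph (n : ℕ) : Set where
  field
    adj        : Fin n → Fin n → Bool
    adj-sym    : ∀ i j → adj i j ≡ adj j i
    adj-irrefl : ∀ i → adj i i ≡ false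

  Adj : Rel (Fin n) 0ℓ
  Adj i j = T (adj i j)

  neighbours : Fin n → Subset n
  neighbours i = tabulate (adj i)

  degree : Fin n → ℕ
  degree i = ∣ neighbours i ∣

  maxDegree : ℕ
  maxDegree = foldr _⊔_ 0 degree

  -- Each edge {i , j} is counted once, at its smaller endpoint.
  size : ℕ
  size = sum λ i → ∣ tabulate (λ j → ⌊ i <? j ⌋ ∧ adj i j) ∣

open Graph public

-- The edges of a subgraph are stored as a graph on the ambient vertex set, in
-- which the vertices outside `verts` are isolated.
record Subgraph {n : ℕ} (G : Graph n) : Set where
  field
    verts   : Subset n
    edges   : Graph n
    edges⊆  : ∀ {i j} → Adj edges i j → Adj G i j
    -- By symmetry, this covers the other endpoint too.
    endpts⊆ : ∀ {i j} → Adj edges i j → i ∈ verts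

open Subgraph public

Connected : ∀ {n} {G : Graph n} → Subgraph G → Set
Connected H = ∀ {i j} → i ∈ verts H → j ∈ verts H → Star (Adj (edges H)) i j

-- "d_G(S) = x"
IsSteinerDistance : ∀ {n} → Graph n → Subset n → ℕ∞ → Set
IsSteinerDistance G S =
  IsMin λ m → Σ[ H ∈ Subgraph G ] (Connected H × S ⊆ verts H × size (edges H) ≡ m)

-- "sdiam₃(G) = x"
IsSdiam₃ : ∀ {n} → Graph n → ℕ∞ → Set
IsSdiam₃ {n} G =
  IsMax λ x → Σ[ S ∈ Subset n ] (∣ S ∣ ≡ 3 × IsSteinerDistance G S x)

-- Membership of G in the class ℋ₃(n , ℓ , d).
ℋ₃ : (n ℓ d : ℕ) → Graph n → Set
ℋ₃ n ℓ d G = maxDegree G ≡ ℓ × ∃[ x ] (IsSdiam₃ G x × x ≤⁺ [ d ])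

-- "e₃(n , ℓ , d) = x"
e₃[_,_,_]≡_ : (n ℓ d : ℕ) → ℕ∞ → Set
e₃[ n , ℓ , d ]≡ x = IsMin (λ m → Σ[ G ∈ Graph n ] (ℋ₃ n ℓ d G × size G ≡ m)) x

{-# OPTIONS --safe #-}
module Submission where

-- A graph has Steiner 3-diameter at most 2 exactly when every three vertices induce a
-- connected graph, that is, when its complement is a matching.  With n = 2 + m, all degrees
-- are then m or m + 1, and they add up to twice the size.  If the maximum degree is m + 1, the
-- sum of the degrees is at least n m + 1, and at least n m + 2 for parity reasons if n is even.
-- If the maximum degree is m, the sum is n m, which is odd when n is odd.  Conversely, the
-- complement of a matching that misses r vertices has degree sum n m + r; take r ≤ 2.

open import Defs
import Algebra.Properties.CommutativeMonoid.Sum as MonoidSum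
import Algebra.Properties.Semiring.Sum as SemiringSum
open import Data.Bool using (Bool; true; false; T; _∧_; _∨_)
open import Data.Bool.Properties using (T-∧; T-∨; ∨-comm; ∧-comm)
import Data.Empty as Empty
open import Data.Fin using (Fin; zero; suc; _<?_; _≟_)
open import Data.Fin.Properties using (<-cmp; <-asym)
open import Data.Fin.Subset
  using (Subset; inside; outside; _∈_; _∉_; _⊆_; ∣_∣; ⁅_⁆; _∪_; _─_; _-_; ∁; ⊥)
open import Data.Fin.Subset.Properties
open import Data.Nat using (ℕ; zero; suc; _+_; _*_; _≤_; _<_; _⊔_; _⊓_; _∸_; _/_; z≤n; s≤s)
open import Data.Nat.Combinatorics using (_C_; nCk+nC[k+1]≡[n+1]C[k+1]; nC1≡n)
open import Data.Nat.Divisibility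
  using (_∣_; _∤_; divides; ∣m+n∣m⇒∣n; ∣m∣n⇒∣m+n; ∣-refl; m∣m*n; ∣m⇒∣m*n)
open import Data.Nat.DivMod using (m/n*n≡m)
open import Data.Nat.Induction using (<-rec)
open import Data.Nat.Primality using (euclidsLemma; prime[2])
open import Data.Nat.Properties hiding (_≟_; <-cmp; <-asym; _<?_)
open import Data.Nat.Tactic.RingSolver using (solve-∀)
open import Data.Product using (_×_; _,_; proj₁; proj₂; ∃-syntax; Σ-syntax)
open import Data.Sum using (_⊎_; inj₁; inj₂; [_,_]′)
open import Data.Vec using (_∷_; []; here; there; lookup; tabulate)
open import Data.Vec.Functional using (foldr)
open import Data.Vec.Properties using ([]=⇒lookup; lookup⇒[]=; lookup∘tabulate; tabulate∘lookup)
open import Function using (_∘_; id; flip)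
open import Function.Bundles using (Equivalence)
open import Relation.Binary using (Rel; tri<; tri≈; tri>)
open import Relation.Binary.Construct.Add.Supremum.NonStrict _≤_ using (_≤⁺_; [_]; ≤⁺-trans)
open import Relation.Binary.Construct.Closure.ReflexiveTransitive using (Star; ε; _◅_; _◅◅_; reverse)
open import Relation.Binary.PropositionalEquality
open import Relation.Nullary using (¬_; yes; no; contradiction)
open import Relation.Nullary.Construct.Add.Supremum using ([_]; ⊤⁺)
open import Relation.Nullary.Decidable using (⌊_⌋; does; decidable-stable)

open MonoidSum +-0-commutativeMonoid using (sum; sum-cong-≗; ∑-distrib-+; ∑-comm)
open SemiringSum +-*-semiring using (*-distribˡ-sum; *-distribʳ-sum)
open Equivalence using (to; from)

private
  variable
    n k : ℕ
    x y : Fin n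
    p q : Subset n
    f g : Fin n → ℕ

-- Sums over Fin n

sum-mono-≤ : (∀ i → f i ≤ g i) → sum f ≤ sum g
sum-mono-≤ {zero}  f≤g = z≤n
sum-mono-≤ {suc n} f≤g = +-mono-≤ (f≤g zero) (sum-mono-≤ (f≤g ∘ suc))

sum-mono-< : (∀ i → f i ≤ g i) → ∀ u → f u < g u → sum f < sum g
sum-mono-< f≤g zero    fu<gu = +-mono-<-≤ fu<gu (sum-mono-≤ (f≤g ∘ suc))
sum-mono-< f≤g (suc u) fu<gu = +-mono-≤-< (f≤g zero) (sum-mono-< (f≤g ∘ suc) u fu<gu)

sum-const : ∀ n k → sum {n} (λ _ → k) ≡ n * k
sum-const zero    k = refl
sum-const (suc n) k = cong (k +_) (sum-const n k)

term≤sum : ∀ (f : Fin n → ℕ) i → f i ≤ sum f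
term≤sum f zero    = m≤m+n _ _
term≤sum f (suc i) = ≤-trans (term≤sum (f ∘ suc) i) (m≤n+m _ _)

0<sum⇒∃0< : ∀ (f : Fin n → ℕ) → 0 < sum f → ∃[ i ] 0 < f i
0<sum⇒∃0< {suc n} f 0<∑ with f zero in eq
... | suc _ = zero , ≤-trans (s≤s z≤n) (≤-reflexive (sym eq))
... | zero  with i , 0<fi ← 0<sum⇒∃0< (f ∘ suc) 0<∑ = suc i , 0<fi

⟦_⟧ : Bool → ℕ
⟦ true  ⟧ = 1
⟦ false ⟧ = 0

⟦∨⟧≤ : ∀ a b → ⟦ a ∨ b ⟧ ≤ ⟦ a ⟧ + ⟦ b ⟧
⟦∨⟧≤ true  b = s≤s z≤n
⟦∨⟧≤ false b = ≤-refl

⟦∧⟧≡ : ∀ a b → ⟦ a ∧ b ⟧ ≡ ⟦ a ⟧ * ⟦ b ⟧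
⟦∧⟧≡ true  b = sym (+-identityʳ _)
⟦∧⟧≡ false b = refl

∣p∣≡sum : ∀ (p : Subset n) → ∣ p ∣ ≡ sum (⟦_⟧ ∘ lookup p)
∣p∣≡sum []            = refl
∣p∣≡sum (inside  ∷ p) = cong suc (∣p∣≡sum p)
∣p∣≡sum (outside ∷ p) = ∣p∣≡sum p

∣tabulate∣≡sum : ∀ (b : Fin n → Bool) → ∣ tabulate b ∣ ≡ sum (⟦_⟧ ∘ b)
∣tabulate∣≡sum {zero}  b = refl
∣tabulate∣≡sum {suc n} b with b zero
... | true  = cong suc (∣tabulate∣≡sum (b ∘ suc))
... | false = ∣tabulate∣≡sum (b ∘ suc)

-- Finite subsets

∈⇒T : x ∈ p → T (lookup p x)
∈⇒T x∈p rewrite []=⇒lookup x∈p = _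

T⇒∈ : ∀ {x : Fin n} {p} → T (lookup p x) → x ∈ p
T⇒∈ {x = x} {p} t with lookup p x in eq
... | true = lookup⇒[]= x p eq

∉⇒lookup≡false : ∀ {x : Fin n} {p} → x ∉ p → lookup p x ≡ false
∉⇒lookup≡false {x = x} {p} x∉p with lookup p x in eq
... | true  = contradiction (lookup⇒[]= x p eq) x∉p
... | false = refl

lookup-cong-⇔ : ∀ {x y : Fin n} {p q} → (x ∈ p → y ∈ q) → (y ∈ q → x ∈ p) → lookup p x ≡ lookup q y
lookup-cong-⇔ {x = x} {p = p} p⇒q q⇒p with x ∈? p
... | yes x∈p = trans ([]=⇒lookup x∈p) (sym ([]=⇒lookup (p⇒q x∈p)))
... | no  x∉p = trans (∉⇒lookup≡false x∉p) (sym (∉⇒lookup≡false (x∉p ∘ q⇒p)))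

x∈p─q⇒x∉q : ∀ (p q : Subset n) → x ∈ p ─ q → x ∉ q
x∈p─q⇒x∉q (_ ∷ p) (_ ∷ q) (there x∈p─q) (there x∈q) = x∈p─q⇒x∉q p q x∈p─q x∈q
x∈p─q⇒x∉q (inside ∷ p) (inside ∷ q) () here
x∈p─q⇒x∉q (outside ∷ p) (inside ∷ q) () here

x∈p-y⇒x∈p : x ∈ p - y → x ∈ p
x∈p-y⇒x∈p {p = p} {y} = p─q⊆p p ⁅ y ⁆

x∈p-y⇒x≢y : x ∈ p - y → x ≢ y
x∈p-y⇒x≢y {p = p} {y} x∈p-y = x∉⁅y⁆⇒x≢y (x∈p─q⇒x∉q p ⁅ y ⁆ x∈p-y)

x∈p⇒∣p∣≡1+∣p-x∣ : x ∈ p → ∣ p ∣ ≡ suc ∣ p - x ∣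
x∈p⇒∣p∣≡1+∣p-x∣ {p = _ ∷ p}       here        = cong (suc ∘ ∣_∣) (sym (p─⊥≡p p))
x∈p⇒∣p∣≡1+∣p-x∣ {p = inside  ∷ p} (there x∈p) = cong suc (x∈p⇒∣p∣≡1+∣p-x∣ x∈p)
x∈p⇒∣p∣≡1+∣p-x∣ {p = outside ∷ p} (there x∈p) = x∈p⇒∣p∣≡1+∣p-x∣ x∈p

∣p-x∣≡ : x ∈ p → ∣ p ∣ ≡ suc k → ∣ p - x ∣ ≡ k
∣p-x∣≡ x∈p ∣p∣≡1+k = cong (_∸ 1) (trans (sym (x∈p⇒∣p∣≡1+∣p-x∣ x∈p)) ∣p∣≡1+k)

x∈p⇒0<∣p∣ : x ∈ p → 0 < ∣ p ∣
x∈p⇒0<∣p∣ x∈p rewrite x∈p⇒∣p∣≡1+∣p-x∣ x∈p = s≤s z≤n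

x≢y⇒1<∣p∣ : x ∈ p → y ∈ p → x ≢ y → 1 < ∣ p ∣
x≢y⇒1<∣p∣ x∈p y∈p x≢y rewrite x∈p⇒∣p∣≡1+∣p-x∣ y∈p = s≤s (x∈p⇒0<∣p∣ (x∈p∧x≢y⇒x∈p-y x∈p x≢y))

0<∣p∣⇒∃∈ : ∀ (p : Subset n) → 0 < ∣ p ∣ → ∃[ x ] x ∈ p
0<∣p∣⇒∃∈ {n} p 0<∣p∣ with nonempty? p
... | yes ne = ne
... | no  ¬ne = contradiction (trans (cong ∣_∣ (Empty-unique ¬ne)) (∣⊥∣≡0 n)) (>⇒≢ 0<∣p∣)

x∉p⇒∣⁅x⁆∪p∣≡1+∣p∣ : ∀ (x : Fin n) p → x ∉ p → ∣ ⁅ x ⁆ ∪ p ∣ ≡ suc ∣ p ∣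
x∉p⇒∣⁅x⁆∪p∣≡1+∣p∣ zero    (inside  ∷ p) x∉p = contradiction here x∉p
x∉p⇒∣⁅x⁆∪p∣≡1+∣p∣ zero    (outside ∷ p) x∉p = cong (suc ∘ ∣_∣) (∪-identityˡ p)
x∉p⇒∣⁅x⁆∪p∣≡1+∣p∣ (suc x) (inside  ∷ p) x∉p = cong suc (x∉p⇒∣⁅x⁆∪p∣≡1+∣p∣ x p (x∉p ∘ there))
x∉p⇒∣⁅x⁆∪p∣≡1+∣p∣ (suc x) (outside ∷ p) x∉p = x∉p⇒∣⁅x⁆∪p∣≡1+∣p∣ x p (x∉p ∘ there)

-- The indicator of `p` lies below `f`. With `f` a degree function, vertices of positive degree thus
-- bound twice the number of edges from below.
∣p∣≤sum : ∀ (p : Subset n) → (∀ {x} → x ∈ p → 0 < f x) → ∣ p ∣ ≤ sum f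
∣p∣≤sum {f = f} p 0<f = subst (_≤ sum f) (sym (∣p∣≡sum p)) (sum-mono-≤ bound)
  where
  bound : ∀ i → ⟦ lookup p i ⟧ ≤ f i
  bound i with lookup p i in eq
  ... | true  = 0<f (lookup⇒[]= i p eq)
  ... | false = z≤n

∣p∣<sum : ∀ (p : Subset n) → (∀ {x} → x ∈ p → 0 < f x) → ∀ u → 1 < f u → ∣ p ∣ < sum f
∣p∣<sum {f = f} p 0<f u 1<fu = subst (_< sum f) (sym (∣p∣≡sum p)) (sum-mono-< bound u (strict (lookup p u)))
  where
  bound : ∀ i → ⟦ lookup p i ⟧ ≤ f i
  bound i with lookup p i in eq
  ... | true  = 0<f (lookup⇒[]= i p eq)
  ... | false = z≤n
  strict : ∀ b → ⟦ b ⟧ < f u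
  strict true  = 1<fu
  strict false = <⇒≤ 1<fu

-- A walk that starts inside `p` and ends outside has a first step that leaves `p`. This turns
-- connectedness into edges across a cut.
Star-exit : ∀ {ℓ} {R : Rel (Fin n) ℓ} (p : Subset n) → Star R x y → x ∈ p → y ∉ p →
            ∃[ u ] ∃[ w ] (u ∈ p × w ∉ p × R u w)
Star-exit p ε x∈p y∉p = contradiction x∈p y∉p
Star-exit p (_◅_ {j = z} Rxz z⇝y) x∈p y∉p with z ∈? p
... | yes z∈p = Star-exit p z⇝y z∈p y∉p
... | no  z∉p = _ , z , x∈p , z∉p , Rxz

-- Degrees

degree≤maxDegree : ∀ (G : Graph n) i → degree G i ≤ maxDegree G
degree≤maxDegree G = go (degree G)
  where
  go : ∀ {n} (f : Fin n → ℕ) i → f i ≤ foldr _⊔_ 0 f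
  go f zero    = m≤m⊔n _ _
  go f (suc i) = m≤n⇒m≤o⊔n (f zero) (go (f ∘ suc) i)

maxDegree≡ : ∀ (G : Graph n) → (∀ i → degree G i ≤ k) → ∀ u → degree G u ≡ k → maxDegree G ≡ k
maxDegree≡ {k = k} G deg≤k u degu≡k =
  ≤-antisym (go (degree G) deg≤k) (subst (_≤ maxDegree G) degu≡k (degree≤maxDegree G u))
  where
  go : ∀ {n} (f : Fin n → ℕ) → (∀ i → f i ≤ k) → foldr _⊔_ 0 f ≤ k
  go {zero}  f f≤k = z≤n
  go {suc n} f f≤k = ⊔-lub (f≤k zero) (go (f ∘ suc) (f≤k ∘ suc))

maxDegree-attained : ∀ (G : Graph (suc n)) → ∃[ u ] degree G u ≡ maxDegree G
maxDegree-attained G = go (degree G)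
  where
  go : ∀ {n} (f : Fin (suc n) → ℕ) → ∃[ u ] f u ≡ foldr _⊔_ 0 f
  go {zero}  f = zero , sym (⊔-identityʳ _)
  go {suc n} f with ⊔-sel (f zero) (foldr _⊔_ 0 (f ∘ suc)) | go (f ∘ suc)
  ... | inj₁ eq | _        = zero , sym eq
  ... | inj₂ eq | u , fu≡ = suc u , trans fu≡ (sym eq)

-- `e` records an edge at its smaller endpoint only, as `size` does. The degrees sum
-- `e i j + e j i`, and exchanging the order of summation makes the two halves equal.
handshake : ∀ (G : Graph n) → sum (degree G) ≡ 2 * size G
handshake G = begin
  sum (degree G)                                    ≡⟨ sum-cong-≗ (λ i → ∣tabulate∣≡sum (adj G i)) ⟩
  sum (λ i → sum λ j → ⟦ adj G i j ⟧)               ≡⟨ sum-cong-≗ (λ i → sum-cong-≗ (split i)) ⟩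
  sum (λ i → sum λ j → e i j + e j i)               ≡⟨ sum-cong-≗ (λ i → ∑-distrib-+ (e i) (flip e i)) ⟩
  sum (λ i → sum (e i) + sum (flip e i))            ≡⟨ ∑-distrib-+ (sum ∘ e) (sum ∘ flip e) ⟩
  sum (sum ∘ e) + sum (sum ∘ flip e)                ≡⟨ cong (sum (sum ∘ e) +_) (∑-comm (flip e)) ⟩
  sum (sum ∘ e) + sum (sum ∘ e)                     ≡⟨ cong (sum (sum ∘ e) +_) (+-identityʳ _) ⟨
  2 * sum (sum ∘ e)                                 ≡⟨ cong (2 *_) (sum-cong-≗ (λ i → ∣tabulate∣≡sum (λ j → ⌊ i <? j ⌋ ∧ adj G i j))) ⟨
  2 * size G                                        ∎
  where
  open ≡-Reasoning
  e : Fin _ → Fin _ → ℕ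
  e i j = ⟦ ⌊ i <? j ⌋ ∧ adj G i j ⟧
  -- Off the diagonal exactly one of the two comparisons holds; on the diagonal both terms vanish,
  -- and irreflexivity makes the left side vanish too.
  split : ∀ i j → ⟦ adj G i j ⟧ ≡ e i j + e j i
  split i j with i <? j | j <? i
  ... | yes i<j | yes j<i = contradiction j<i (<-asym i<j)
  ... | yes _   | no  _   = sym (+-identityʳ _)
  ... | no  _   | yes _   = cong ⟦_⟧ (adj-sym G i j)
  ... | no  i≮j | no  j≮i with <-cmp i j
  ... | tri< i<j _ _    = contradiction i<j i≮j
  ... | tri≈ _ refl _   = cong ⟦_⟧ (adj-irrefl G i)
  ... | tri> _ _ j<i    = contradiction j<i j≮i

Adj-sym : ∀ (G : Graph n) → Adj G x y → Adj G y x
Adj-sym G = subst T (adj-sym G _ _)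

Adj⇒≢ : ∀ (G : Graph n) → Adj G x y → x ≢ y
Adj⇒≢ {x = x} G xy refl = subst T (adj-irrefl G x) xy

Adj⇒∈ : ∀ (G : Graph n) → Adj G x y → y ∈ neighbours G x
Adj⇒∈ {x = x} {y} G xy = T⇒∈ (subst T (sym (lookup∘tabulate (adj G x) y)) xy)

∈⇒Adj : ∀ (G : Graph n) → y ∈ neighbours G x → Adj G x y
∈⇒Adj {y = y} {x} G y∈ = subst T (lookup∘tabulate (adj G x) y) (∈⇒T y∈)

-- Steiner distances

module _ {G : Graph n} (H : Subgraph G) (conn : Connected H) where

  -- The first step of a walk from `x` to another vertex is an edge at `x`.
  connected⇒0<degree : x ∈ verts H → y ∈ verts H → x ≢ y → 0 < degree (edges H) x
  connected⇒0<degree x∈ y∈ x≢y with conn x∈ y∈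
  ... | ε      = contradiction refl x≢y
  ... | xz ◅ _ = x∈p⇒0<∣p∣ (Adj⇒∈ (edges H) xz)

  -- All three vertices of `S` have positive degree, so the degree sum is at least 3; a single edge
  -- provides only 2.
  connected-size≥2 : ∀ {S} → ∣ S ∣ ≡ 3 → S ⊆ verts H → 2 ≤ size (edges H)
  connected-size≥2 {S} ∣S∣≡3 S⊆H = ≮⇒≥ λ size<2 →
    contradiction (≤-trans 3≤2size (*-monoʳ-≤ 2 (≤-pred size<2))) λ { (s≤s (s≤s ())) }
    where
    0<degree : ∀ {x} → x ∈ S → 0 < degree (edges H) x
    0<degree {x} x∈S
      with y , y∈ ← 0<∣p∣⇒∃∈ (S - x) (subst (0 <_) (sym (∣p-x∣≡ x∈S ∣S∣≡3)) (s≤s z≤n))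
      = connected⇒0<degree (S⊆H x∈S) (S⊆H (x∈p-y⇒x∈p y∈)) (x∈p-y⇒x≢y y∈ ∘ sym)
    3≤2size : 3 ≤ 2 * size (edges H)
    3≤2size = subst₂ _≤_ ∣S∣≡3 (handshake (edges H)) (∣p∣≤sum S 0<degree)

  -- v has a neighbour c outside {a , b}, and some edge leaves {v , c}: the four vertices
  -- v, c, a, b have positive degree and v or c has degree at least 2, so that the degrees
  -- add up to at least 5.
  nonadjacent⇒size≥3 : ∀ {v a b} → v ∈ verts H → a ∈ verts H → b ∈ verts H →
                       v ≢ a → v ≢ b → a ≢ b → ¬ Adj G v a → ¬ Adj G v b → 3 ≤ size (edges H)
  nonadjacent⇒size≥3 {v} {a} {b} v∈ a∈ b∈ v≢a v≢b a≢b ¬va ¬vb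
    with v′ , c , v′∈ , c∉ , vc ← Star-exit ⁅ v ⁆ (conn v∈ a∈) (x∈⁅x⁆ v) (x≢y⇒x∉⁅y⁆ (v≢a ∘ sym))
    with refl ← x∈⁅y⁆⇒x≡y v v′∈
    with u , w , u∈ , w∉ , uw ← Star-exit (⁅ v ⁆ ∪ ⁅ c ⁆) (conn v∈ a∈) (p⊆p∪q ⁅ c ⁆ (x∈⁅x⁆ v))
           ([ x≢y⇒x∉⁅y⁆ (v≢a ∘ sym) , x≢y⇒x∉⁅y⁆ {y = c} (λ { refl → ¬va (edges⊆ H vc) }) ]′ ∘ x∈p∪q⁻ ⁅ v ⁆ ⁅ c ⁆)
    = ≮⇒≥ λ size<3 →
        contradiction (≤-trans 5≤2size (*-monoʳ-≤ 2 (≤-pred size<3))) λ { (s≤s (s≤s (s≤s (s≤s ())))) }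
    where
    c≢a : c ≢ a
    c≢a refl = ¬va (edges⊆ H vc)
    c≢b : c ≢ b
    c≢b refl = ¬vb (edges⊆ H vc)
    ∉-insert : ∀ {x y : Fin n} {p} → x ≢ y → x ∉ p → x ∉ ⁅ y ⁆ ∪ p
    ∉-insert {y = y} {p} x≢y x∉p = [ x≢y⇒x∉⁅y⁆ x≢y , x∉p ]′ ∘ x∈p∪q⁻ ⁅ y ⁆ p
    Q : Subset n
    Q = ⁅ v ⁆ ∪ (⁅ c ⁆ ∪ (⁅ a ⁆ ∪ ⁅ b ⁆))
    ∣Q∣≡4 : ∣ Q ∣ ≡ 4
    ∣Q∣≡4
      rewrite x∉p⇒∣⁅x⁆∪p∣≡1+∣p∣ v _ (∉-insert (Adj⇒≢ (edges H) vc) (∉-insert v≢a (x≢y⇒x∉⁅y⁆ v≢b)))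
            | x∉p⇒∣⁅x⁆∪p∣≡1+∣p∣ c _ (∉-insert c≢a (x≢y⇒x∉⁅y⁆ c≢b))
            | x∉p⇒∣⁅x⁆∪p∣≡1+∣p∣ a _ (x≢y⇒x∉⁅y⁆ a≢b)
            | ∣⁅x⁆∣≡1 b = refl
    cv : Adj (edges H) c v
    cv = Adj-sym (edges H) vc
    0<degree : ∀ {x} → x ∈ Q → 0 < degree (edges H) x
    0<degree x∈p with x∈p∪q⁻ ⁅ v ⁆ _ x∈p
    ... | inj₁ x∈ rewrite x∈⁅y⁆⇒x≡y _ x∈ = connected⇒0<degree v∈ a∈ v≢a
    ... | inj₂ x∈p with x∈p∪q⁻ ⁅ c ⁆ _ x∈p
    ... | inj₁ x∈ rewrite x∈⁅y⁆⇒x≡y _ x∈ = x∈p⇒0<∣p∣ (Adj⇒∈ (edges H) cv)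
    ... | inj₂ x∈p with x∈p∪q⁻ ⁅ a ⁆ _ x∈p
    ... | inj₁ x∈ rewrite x∈⁅y⁆⇒x≡y _ x∈ = connected⇒0<degree a∈ b∈ a≢b
    ... | inj₂ x∈ rewrite x∈⁅y⁆⇒x≡y _ x∈ = connected⇒0<degree b∈ a∈ (a≢b ∘ sym)
    -- The two neighbours are `w` and the other vertex of the pair `v`, `c`; they differ because `w`
    -- lies outside the pair.
    1<degree : ∀ {u} → u ∈ ⁅ v ⁆ ∪ ⁅ c ⁆ → Adj (edges H) u w → 1 < degree (edges H) u
    1<degree u∈ uw with x∈p∪q⁻ ⁅ v ⁆ ⁅ c ⁆ u∈
    ... | inj₁ u∈ rewrite x∈⁅y⁆⇒x≡y _ u∈ = x≢y⇒1<∣p∣ (Adj⇒∈ (edges H) uw) (Adj⇒∈ (edges H) vc)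
                                             λ { refl → w∉ (q⊆p∪q ⁅ v ⁆ _ (x∈⁅x⁆ w)) }
    ... | inj₂ u∈ rewrite x∈⁅y⁆⇒x≡y _ u∈ = x≢y⇒1<∣p∣ (Adj⇒∈ (edges H) uw) (Adj⇒∈ (edges H) cv)
                                             λ { refl → w∉ (p⊆p∪q ⁅ c ⁆ (x∈⁅x⁆ w)) }
    5≤2size : 5 ≤ 2 * size (edges H)
    5≤2size = subst₂ _<_ ∣Q∣≡4 (handshake (edges H)) (∣p∣<sum Q 0<degree u (1<degree u∈ uw))

-- A Steiner distance exists only up to double negation; the bound drawn from it is decidable.
¬¬-IsMin : ∀ (P : ℕ → Set) → ¬ ¬ (∃[ x ] IsMin P x)
¬¬-IsMin P ¬min = ¬min (⊤⁺ , <-rec _ none)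
  where
  -- A least element of `P` would be a minimum, so strong induction shows that `P` is empty; but
  -- then ∞ is its minimum.
  none : ∀ m → (∀ {k} → k < m → ¬ P k) → ¬ P m
  none m ¬P< Pm = ¬min ([ m ] , Pm , λ k Pk → ≮⇒≥ λ k<m → ¬P< k<m Pk)

-- A vertex `v` of degree below `m` has two non-neighbours `a` and `b` besides itself, and
-- `nonadjacent⇒size≥3` then puts the Steiner distance of `v`, `a`, `b` above 2.
degree≥ : ∀ {m ℓ} (G : Graph (2 + m)) → ℋ₃ (2 + m) ℓ 2 G → ∀ v → m ≤ degree G v
degree≥ {m} G (_ , x , (_ , max) , x≤2) v = decidable-stable (m ≤? degree G v) λ deg≱m →
  -- `W` contains `v` itself, so three elements are needed to find `a` and `b`.
  let W = ∁ (neighbours G v)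
      v∈W : v ∈ W
      v∈W = x∉p⇒x∈∁p λ v∈ → Adj⇒≢ G (∈⇒Adj G v∈) refl
      3≤∣W∣ : 3 ≤ ∣ W ∣
      3≤∣W∣ = subst (3 ≤_) (sym (∣∁p∣≡n∸∣p∣ (neighbours G v)))
                (m+n≤o⇒m≤o∸n 3 (s≤s (s≤s (≰⇒> deg≱m))))
      2≤∣W-v∣ = ≤-pred (subst (3 ≤_) (x∈p⇒∣p∣≡1+∣p-x∣ v∈W) 3≤∣W∣)
      a , a∈ = 0<∣p∣⇒∃∈ (W - v) (<⇒≤ 2≤∣W-v∣)
      1≤∣W-v-a∣ = ≤-pred (subst (2 ≤_) (x∈p⇒∣p∣≡1+∣p-x∣ a∈) 2≤∣W-v∣)
      b , b∈ = 0<∣p∣⇒∃∈ (W - v - a) 1≤∣W-v-a∣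
      b∈W-v = x∈p-y⇒x∈p b∈
      ¬Adj : ∀ {x} → x ∈ W - v → ¬ Adj G v x
      ¬Adj x∈ vx = x∈p⇒x∉∁p (Adj⇒∈ G vx) (x∈p-y⇒x∈p x∈)
  in far (x∈p-y⇒x≢y a∈ ∘ sym) (x∈p-y⇒x≢y b∈W-v ∘ sym) (x∈p-y⇒x≢y b∈ ∘ sym) (¬Adj a∈) (¬Adj b∈W-v)
  where
  far : ∀ {a b} → v ≢ a → v ≢ b → a ≢ b → ¬ Adj G v a → ¬ Adj G v b → Empty.⊥
  far {a} {b} v≢a v≢b a≢b ¬va ¬vb = ¬¬-IsMin _ λ (y , dist) →
    bound y dist (≤⁺-trans ≤-trans (max y (S , ∣S∣≡3 , dist)) x≤2)
    where
    S : Subset (2 + m)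
    S = ⁅ v ⁆ ∪ (⁅ a ⁆ ∪ ⁅ b ⁆)
    ∣S∣≡3 : ∣ S ∣ ≡ 3
    ∣S∣≡3
      rewrite x∉p⇒∣⁅x⁆∪p∣≡1+∣p∣ v (⁅ a ⁆ ∪ ⁅ b ⁆) ([ x≢y⇒x∉⁅y⁆ v≢a , x≢y⇒x∉⁅y⁆ v≢b ]′ ∘ x∈p∪q⁻ ⁅ a ⁆ ⁅ b ⁆)
            | x∉p⇒∣⁅x⁆∪p∣≡1+∣p∣ a _ (x≢y⇒x∉⁅y⁆ a≢b)
            | ∣⁅x⁆∣≡1 b = refl
    -- Only a finite distance can be at most 2, so a connected subgraph attaining it is at hand.
    bound : ∀ y → IsSteinerDistance G S y → ¬ (y ≤⁺ [ 2 ])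
    bound _ ((H , conn , S⊆H , refl) , _) [ size≤2 ] = <⇒≱
      (nonadjacent⇒size≥3 H conn
        (S⊆H (p⊆p∪q _ (x∈⁅x⁆ v)))
        (S⊆H (q⊆p∪q ⁅ v ⁆ _ (p⊆p∪q _ (x∈⁅x⁆ a))))
        (S⊆H (q⊆p∪q ⁅ v ⁆ _ (q⊆p∪q ⁅ a ⁆ _ (x∈⁅x⁆ b))))
        v≢a v≢b a≢b ¬va ¬vb) size≤2

-- Complete bipartite graphs

∑∑-product : ∀ (f g : Fin n → ℕ) → sum (λ i → sum λ j → f i * g j) ≡ sum f * sum g
∑∑-product f g = trans (sum-cong-≗ (λ i → sym (*-distribˡ-sum (f i) g))) (sym (*-distribʳ-sum (sum g) f))

-- With `p` a singleton this is a star, the shape of the Steiner trees constructed below.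
completeBipartite : ∀ (p q : Subset n) → (∀ {x} → x ∈ p → x ∉ q) → Graph n
completeBipartite p q disjoint = record
  { adj        = λ i j → (lookup p i ∧ lookup q j) ∨ (lookup q i ∧ lookup p j)
  ; adj-sym    = λ i j → trans (∨-comm (lookup p i ∧ lookup q j) _)
                           (cong₂ _∨_ (∧-comm (lookup q i) _) (∧-comm (lookup p i) _))
  ; adj-irrefl = irrefl
  }
  where
  irrefl : ∀ i → (lookup p i ∧ lookup q i) ∨ (lookup q i ∧ lookup p i) ≡ false
  irrefl i with i ∈? p
  ... | yes i∈p rewrite []=⇒lookup i∈p | ∉⇒lookup≡false (disjoint i∈p) = refl
  ... | no  i∉p rewrite ∉⇒lookup≡false i∉p | ∧-comm (lookup q i) false = refl

module _ {p q : Subset n} (disjoint : ∀ {x} → x ∈ p → x ∉ q) where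

  private
    K : Graph n
    K = completeBipartite p q disjoint

  Adj-completeBipartite⁺ : x ∈ p → y ∈ q → Adj K x y
  Adj-completeBipartite⁺ x∈p y∈q = from T-∨ (inj₁ (from T-∧ (∈⇒T x∈p , ∈⇒T y∈q)))

  Adj-completeBipartite⁻ : Adj K x y → (x ∈ p × y ∈ q) ⊎ (x ∈ q × y ∈ p)
  Adj-completeBipartite⁻ {x = x} {y} xy with to (T-∨ {lookup p x ∧ lookup q y}) xy
  ... | inj₁ t with to (T-∧ {lookup p x}) t
  ...   | x∈p , y∈q = inj₁ (T⇒∈ x∈p , T⇒∈ y∈q)
  Adj-completeBipartite⁻ {x = x} {y} xy | inj₂ t with to (T-∧ {lookup q x}) t
  ...   | x∈q , y∈p = inj₂ (T⇒∈ x∈q , T⇒∈ y∈p)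

  -- In terms of the indicators `a` and `b`, adjacency is at most `a i * b j + b i * a j`, whose
  -- double sum factors. An upper bound suffices, since `connected-size≥2` gives the opposite
  -- inequality for the stars.
  size-completeBipartite≤ : size K ≤ ∣ p ∣ * ∣ q ∣
  size-completeBipartite≤ = *-cancelˡ-≤ 2 (begin
    2 * size K                                               ≡⟨ handshake K ⟨
    sum (degree K)                                           ≡⟨ sum-cong-≗ (λ i → ∣tabulate∣≡sum (adj K i)) ⟩
    sum (λ i → sum λ j → ⟦ adj K i j ⟧)                      ≤⟨ sum-mono-≤ (λ i → sum-mono-≤ (bound i)) ⟩
    sum (λ i → sum λ j → a i * b j + b i * a j)              ≡⟨ sum-cong-≗ (λ i → ∑-distrib-+ (λ j → a i * b j) (λ j → b i * a j)) ⟩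
    sum (λ i → sum (λ j → a i * b j) + sum λ j → b i * a j)  ≡⟨ ∑-distrib-+ (λ i → sum (λ j → a i * b j)) (λ i → sum λ j → b i * a j) ⟩
    sum (λ i → sum (λ j → a i * b j)) + sum (λ i → sum (λ j → b i * a j))
                                                             ≡⟨ cong₂ _+_ (∑∑-product a b) (∑∑-product b a) ⟩
    sum a * sum b + sum b * sum a                            ≡⟨ cong₂ (λ s t → s * t + t * s) (∣p∣≡sum p) (∣p∣≡sum q) ⟨
    ∣ p ∣ * ∣ q ∣ + ∣ q ∣ * ∣ p ∣                            ≡⟨ swap ∣ p ∣ ∣ q ∣ ⟩
    2 * (∣ p ∣ * ∣ q ∣)                                      ∎)
    where
    open ≤-Reasoning
    a b : Fin n → ℕ
    a = ⟦_⟧ ∘ lookup p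
    b = ⟦_⟧ ∘ lookup q
    swap : ∀ s t → s * t + t * s ≡ 2 * (s * t)
    swap = solve-∀
    bound : ∀ i j → ⟦ adj K i j ⟧ ≤ a i * b j + b i * a j
    bound i j = ≤-trans (⟦∨⟧≤ (lookup p i ∧ lookup q j) _)
      (≤-reflexive (cong₂ _+_ (⟦∧⟧≡ (lookup p i) _) (⟦∧⟧≡ (lookup q i) _)))

-- The star on `S` with centre `c` has two edges, and `connected-size≥2` excludes anything smaller.
dominated⇒steinerDistance≡2 : ∀ (G : Graph n) {S c} → ∣ S ∣ ≡ 3 → c ∈ S → (∀ {x} → x ∈ S - c → Adj G c x) →
                              IsSteinerDistance G S [ 2 ]
dominated⇒steinerDistance≡2 {n} G {S} {c} ∣S∣≡3 c∈S cx =
  (H , conn , id , ≤-antisym size≤2 (connected-size≥2 H conn ∣S∣≡3 id)) ,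
  λ { _ (H′ , conn′ , S⊆H′ , refl) → connected-size≥2 H′ conn′ ∣S∣≡3 S⊆H′ }
  where
  disjoint : ∀ {x} → x ∈ ⁅ c ⁆ → x ∉ S - c
  disjoint x∈ x∈S-c = x∈p-y⇒x≢y x∈S-c (x∈⁅y⁆⇒x≡y c x∈)
  star⊆ : ∀ {x y} → Adj (completeBipartite ⁅ c ⁆ (S - c) disjoint) x y → Adj G x y × x ∈ S
  star⊆ xy with Adj-completeBipartite⁻ disjoint xy
  ... | inj₁ (x∈ , y∈) rewrite x∈⁅y⁆⇒x≡y c x∈ = cx y∈ , c∈S
  ... | inj₂ (x∈ , y∈) rewrite x∈⁅y⁆⇒x≡y c y∈ = Adj-sym G (cx x∈) , x∈p-y⇒x∈p x∈
  H : Subgraph G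
  H = record
    { verts   = S
    ; edges   = completeBipartite ⁅ c ⁆ (S - c) disjoint
    ; edges⊆  = proj₁ ∘ star⊆
    ; endpts⊆ = proj₂ ∘ star⊆
    }
  centre⇝ : ∀ {x} → x ∈ S → Star (Adj (edges H)) c x
  centre⇝ {x} x∈S with x ≟ c
  ... | yes refl = ε
  ... | no  x≢c  = Adj-completeBipartite⁺ disjoint (x∈⁅x⁆ c) (x∈p∧x≢y⇒x∈p-y x∈S x≢c) ◅ ε
  conn : Connected H
  conn x∈S y∈S = reverse (Adj-sym (edges H)) (centre⇝ x∈S) ◅◅ centre⇝ y∈S
  size≤2 : size (edges H) ≤ 2
  size≤2 = subst (size (edges H) ≤_) (cong₂ _*_ (∣⁅x⁆∣≡1 c) (∣p-x∣≡ c∈S ∣S∣≡3)) (size-completeBipartite≤ disjoint)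

-- Complements of matchings

-- A matching is encoded by the involution that exchanges the endpoints of its edges.
module _ (σ : Fin n → Fin n) (σ-involutive : ∀ i → σ (σ i) ≡ i) where

  private
    -- Including `i` itself rules out loops. For a vertex missed by the matching, that is, a fixed
    -- point of `σ`, the set is a singleton.
    nonadjacent : Fin n → Subset n
    nonadjacent i = ⁅ i ⁆ ∪ ⁅ σ i ⁆

    nonadjacent-sym : x ∈ nonadjacent y → y ∈ nonadjacent x
    nonadjacent-sym {x} {y} x∈ with x∈p∪q⁻ ⁅ y ⁆ ⁅ σ y ⁆ x∈
    ... | inj₁ x∈ rewrite x∈⁅y⁆⇒x≡y _ x∈ = p⊆p∪q _ (x∈⁅x⁆ y)
    ... | inj₂ x∈ rewrite x∈⁅y⁆⇒x≡y _ x∈ =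
      q⊆p∪q ⁅ σ y ⁆ _ (subst (λ z → y ∈ ⁅ z ⁆) (sym (σ-involutive y)) (x∈⁅x⁆ y))

  matchingComplement : Graph n
  matchingComplement = record
    { adj        = λ i j → lookup (∁ (nonadjacent i)) j
    ; adj-sym    = λ i j → lookup-cong-⇔ {p = ∁ (nonadjacent i)} ∁-sym ∁-sym
    ; adj-irrefl = λ i → ∉⇒lookup≡false (x∈p⇒x∉∁p (p⊆p∪q ⁅ σ i ⁆ (x∈⁅x⁆ i)))
    }
    where
    ∁-sym : x ∈ ∁ (nonadjacent y) → y ∈ ∁ (nonadjacent x)
    ∁-sym x∈ = x∉p⇒x∈∁p λ y∈ → x∈p⇒x∉∁p (nonadjacent-sym y∈) x∈

  Adj-matchingComplement : y ≢ x → y ≢ σ x → Adj matchingComplement x y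
  Adj-matchingComplement {x = x} y≢x y≢σx = ∈⇒T (x∉p⇒x∈∁p
    ([ x≢y⇒x∉⁅y⁆ y≢x , x≢y⇒x∉⁅y⁆ y≢σx ]′ ∘ x∈p∪q⁻ ⁅ x ⁆ ⁅ σ x ⁆))

  -- A missed vertex is adjacent to all `1 + m` others, a matched one to all but its partner. The
  -- order is given by an equation because it is later of the form `q * 2 + r`.
  degree-matchingComplement : ∀ {m} → n ≡ 2 + m → ∀ i →
                              degree matchingComplement i ≡ m + ⟦ does (σ i ≟ i) ⟧
  degree-matchingComplement {m} n≡2+m i
    rewrite tabulate∘lookup (∁ (nonadjacent i)) | ∣∁p∣≡n∸∣p∣ (nonadjacent i) with σ i ≟ i
  ... | yes σi≡i rewrite σi≡i | ∪-idem ⁅ i ⁆ | ∣⁅x⁆∣≡1 i = trans (cong (_∸ 1) n≡2+m) (+-comm 1 m)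
  ... | no  σi≢i rewrite x∉p⇒∣⁅x⁆∪p∣≡1+∣p∣ i ⁅ σ i ⁆ (x≢y⇒x∉⁅y⁆ (σi≢i ∘ sym)) | ∣⁅x⁆∣≡1 (σ i) =
    trans (cong (_∸ 2) n≡2+m) (sym (+-identityʳ m))

  -- A set of odd size is not a union of edges of the matching.
  matchingComplement-centre : ∀ {S} → ∣ S ∣ ≡ 3 → ∃[ c ] (c ∈ S × σ c ∉ S - c)
  matchingComplement-centre {S} ∣S∣≡3 with 0<∣p∣⇒∃∈ S (subst (0 <_) (sym ∣S∣≡3) (s≤s z≤n))
  ... | a , a∈S with σ a ∈? S - a
  ... | no  σa∉ = a , a∈S , σa∉
  -- Now `a` and its partner are both in `S`. The partner of the third vertex `c` can be neither of
  -- them, so if it were in `S - c` it would be a fourth element.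
  ... | yes σa∈ with 0<∣p∣⇒∃∈ (S - a - σ a) (subst (0 <_) (sym (∣p-x∣≡ σa∈ (∣p-x∣≡ a∈S ∣S∣≡3))) (s≤s z≤n))
  ... | c , c∈ = c , x∈p-y⇒x∈p c∈S-a , λ σc∈ →
    let σc∈S-a  = x∈p∧x≢y⇒x∈p-y (x∈p-y⇒x∈p σc∈) λ σc≡a → x∈p-y⇒x≢y c∈ (trans (sym (σ-involutive c)) (cong σ σc≡a))
        σc∈S-ab = x∈p∧x≢y⇒x∈p-y σc∈S-a λ σc≡σa →
                    x∈p-y⇒x≢y c∈S-a (trans (sym (σ-involutive c)) (trans (cong σ σc≡σa) (σ-involutive a)))
    in n≮0 (subst (0 <_) (∣p-x∣≡ c∈ (∣p-x∣≡ σa∈ (∣p-x∣≡ a∈S ∣S∣≡3)))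
              (x∈p⇒0<∣p∣ (x∈p∧x≢y⇒x∈p-y σc∈S-ab (x∈p-y⇒x≢y σc∈))))
    where c∈S-a = x∈p-y⇒x∈p c∈

  -- Every triple contains a vertex adjacent to the other two, hence has distance exactly 2; `3 ≤ n`
  -- provides a triple at which the maximum is attained.
  sdiam₃-matchingComplement : 3 ≤ n → IsSdiam₃ matchingComplement [ 2 ]
  sdiam₃-matchingComplement 3≤n = (let S , ∣S∣≡3 = triple 3≤n in S , ∣S∣≡3 , dist≡2 ∣S∣≡3) , λ where
      [ k ] (S , ∣S∣≡3 , _ , min) → [ min 2 (proj₁ (dist≡2 ∣S∣≡3)) ]
      ⊤⁺    (S , ∣S∣≡3 , none)    → contradiction (proj₁ (dist≡2 ∣S∣≡3)) (none 2)
    where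
    triple : ∀ {n} → 3 ≤ n → Σ[ S ∈ Subset n ] ∣ S ∣ ≡ 3
    triple (s≤s (s≤s (s≤s {n = k} _))) = inside ∷ inside ∷ inside ∷ ⊥ , cong (3 +_) (∣⊥∣≡0 k)
    dist≡2 : ∀ {S} → ∣ S ∣ ≡ 3 → IsSteinerDistance matchingComplement S [ 2 ]
    dist≡2 {S} ∣S∣≡3 with c , c∈S , σc∉ ← matchingComplement-centre ∣S∣≡3 =
      dominated⇒steinerDistance≡2 matchingComplement ∣S∣≡3 c∈S λ x∈ →
        Adj-matchingComplement (x∈p-y⇒x≢y x∈) λ x≡σc → σc∉ (subst (_∈ S - c) x≡σc x∈)

-- The matching of `q` edges on consecutive vertices, which misses the last `r` vertices.
pairing : ∀ q r → Fin (q * 2 + r) → Fin (q * 2 + r)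
pairing zero    r i             = i
pairing (suc q) r zero          = suc zero
pairing (suc q) r (suc zero)    = zero
pairing (suc q) r (suc (suc i)) = suc (suc (pairing q r i))

pairing-involutive : ∀ q r i → pairing q r (pairing q r i) ≡ i
pairing-involutive zero    r i             = refl
pairing-involutive (suc q) r zero          = refl
pairing-involutive (suc q) r (suc zero)    = refl
pairing-involutive (suc q) r (suc (suc i)) = cong (λ j → suc (suc j)) (pairing-involutive q r i)

pairing-fixed : ∀ q r → sum (λ i → ⟦ does (pairing q r i ≟ i) ⟧) ≡ r
pairing-fixed zero    r = trans (sum-cong-≗ {r} fixed) (trans (sum-const r 1) (*-identityʳ r))
  where
  fixed : ∀ i → ⟦ does (i ≟ i) ⟧ ≡ 1
  fixed i with i ≟ i
  ... | yes _  = refl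
  ... | no i≢i = contradiction refl i≢i
-- The two exchanged vertices contribute 0, and `does` computes through the two successors on the
-- rest.
pairing-fixed (suc q) r = pairing-fixed q r

-- The term `r ⊓ 1` tells whether some vertex is missed: just the missed vertices have degree
-- `1 + m`, all others have degree `m`.
extremal : ∀ {m ℓ} q r → n ≡ q * 2 + r → n ≡ 2 + m → 3 ≤ n → ℓ ≡ m + (r ⊓ 1) →
           Σ[ G ∈ Graph n ] (ℋ₃ n ℓ 2 G × 2 * size G ≡ n * m + r)
extremal {n} {m} q r refl n≡2+m 3≤n ℓ≡ =
  G , (trans (maxDegreeG r refl) (sym ℓ≡) , [ 2 ] , sdiam₃-matchingComplement σ σ² 3≤n , [ ≤-refl ]) , 2size
  where
  σ  = pairing q r
  σ² = pairing-involutive q r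
  G : Graph n
  G = matchingComplement σ σ²
  fixed : Fin n → ℕ
  fixed i = ⟦ does (σ i ≟ i) ⟧
  degreeG : ∀ i → degree G i ≡ m + fixed i
  degreeG = degree-matchingComplement σ σ² n≡2+m
  maxDegreeG≡ : (∀ i → fixed i ≤ k) → ∀ u → fixed u ≡ k → maxDegree G ≡ m + k
  maxDegreeG≡ fixed≤k u fixedu≡k = maxDegree≡ G
    (λ i → ≤-trans (≤-reflexive (degreeG i)) (+-monoʳ-≤ m (fixed≤k i))) u
    (trans (degreeG u) (cong (m +_) fixedu≡k))
  fixed≤1 : ∀ i → fixed i ≤ 1
  fixed≤1 i with does (σ i ≟ i)
  ... | true  = s≤s z≤n
  ... | false = z≤n
  -- The case split is on a copy of `r`, since `n`, `σ` and `G` depend on `r` itself.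
  maxDegreeG : ∀ r′ → r ≡ r′ → maxDegree G ≡ m + (r′ ⊓ 1)
  maxDegreeG zero r≡0 = maxDegreeG≡ fixed≤0 u (n≤0⇒n≡0 (fixed≤0 u))
    where
    fixed≤0 : ∀ i → fixed i ≤ 0
    fixed≤0 i = subst (fixed i ≤_) (trans (pairing-fixed q r) r≡0) (term≤sum fixed i)
    u = subst Fin (sym n≡2+m) zero
  maxDegreeG (suc r′) r≡1+r′
    with u , 0<fixedu ← 0<sum⇒∃0< fixed (subst (0 <_) (sym (trans (pairing-fixed q r) r≡1+r′)) (s≤s z≤n))
    = trans (maxDegreeG≡ fixed≤1 u (≤-antisym (fixed≤1 u) 0<fixedu)) (cong (λ k → m + suc k) (sym (⊓-zeroʳ r′)))
  2size : 2 * size G ≡ n * m + r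
  2size = begin
    2 * size G                    ≡⟨ handshake G ⟨
    sum (degree G)                ≡⟨ sum-cong-≗ degreeG ⟩
    sum (λ i → m + fixed i)       ≡⟨ ∑-distrib-+ (λ _ → m) fixed ⟩
    sum {n} (λ _ → m) + sum fixed ≡⟨ cong₂ _+_ (sum-const n m) (pairing-fixed q r) ⟩
    n * m + r                     ∎
    where open ≡-Reasoning

-- The extremal sizes

2*[nC2]≡n*[n-1] : ∀ n → 2 * (suc n C 2) ≡ suc n * n
2*[nC2]≡n*[n-1] zero    = refl
2*[nC2]≡n*[n-1] (suc n) = begin
  2 * (suc (suc n) C 2)                 ≡⟨ cong (2 *_) (nCk+nC[k+1]≡[n+1]C[k+1] (suc n) 1) ⟨
  2 * (suc n C 1 + suc n C 2)           ≡⟨ cong (λ c → 2 * (c + suc n C 2)) (nC1≡n (suc n)) ⟩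
  2 * (suc n + suc n C 2)               ≡⟨ *-distribˡ-+ 2 (suc n) _ ⟩
  2 * suc n + 2 * (suc n C 2)           ≡⟨ cong (2 * suc n +_) (2*[nC2]≡n*[n-1] n) ⟩
  2 * suc n + suc n * n                 ≡⟨ ring n ⟩
  suc (suc n) * suc n                   ∎
  where
  open ≡-Reasoning
  ring : ∀ n → 2 * suc n + suc n * n ≡ suc (suc n) * suc n
  ring = solve-∀

-- Here `h` is the number of matched vertices, so `h / 2` counts the missing edges. Evenness of `h`
-- makes the division exact, and the equation keeps the subtraction from truncating.
2*[nC2∸h/2] : ∀ m h {k} → 2 ∣ h → (2 + m) * (1 + m) ≡ k + h → 2 * ((2 + m) C 2 ∸ h / 2) ≡ k
2*[nC2∸h/2] m h {k} 2∣h eq = begin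
  2 * ((2 + m) C 2 ∸ h / 2)             ≡⟨ *-distribˡ-∸ 2 ((2 + m) C 2) (h / 2) ⟩
  2 * ((2 + m) C 2) ∸ 2 * (h / 2)       ≡⟨ cong₂ _∸_ (2*[nC2]≡n*[n-1] (1 + m)) (trans (*-comm 2 (h / 2)) (m/n*n≡m 2∣h)) ⟩
  (2 + m) * (1 + m) ∸ h                 ≡⟨ cong (_∸ h) eq ⟩
  k + h ∸ h                             ≡⟨ m+n∸n≡m k h ⟩
  k                                     ∎
  where open ≡-Reasoning

even⊎odd : ∀ n → (∃[ q ] n ≡ q * 2) ⊎ (∃[ q ] n ≡ suc (q * 2))
even⊎odd zero = inj₁ (0 , refl)
even⊎odd (suc n) with even⊎odd n
... | inj₁ (q , refl) = inj₂ (q , refl)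
... | inj₂ (q , refl) = inj₁ (suc q , refl)

odd : 2 ∤ n → ∃[ q ] n ≡ suc (q * 2)
odd {n} 2∤n with even⊎odd n
... | inj₁ (q , n≡) = contradiction (divides q n≡) 2∤n
... | inj₂ n-odd     = n-odd

-- All degrees are at least `m`, and a vertex attaining the maximum degree makes the sum strictly
-- larger.
size-lower : ∀ {m} (G : Graph (2 + m)) → ℋ₃ (2 + m) (1 + m) 2 G → (2 + m) * m < 2 * size G
size-lower {m} G G∈ with u , degu≡ ← maxDegree-attained G =
  subst₂ _<_ (sum-const (2 + m) m) (handshake G)
    (sum-mono-< (degree≥ G G∈) u (≤-reflexive (sym (trans degu≡ (proj₁ G∈)))))

-- The maximum degree meets the lower bound `degree≥`, so the graph is `m`-regular.
size-regular : ∀ {m} (G : Graph (2 + m)) → ℋ₃ (2 + m) m 2 G → 2 * size G ≡ (2 + m) * m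
size-regular {m} G G∈ = begin
  2 * size G             ≡⟨ handshake G ⟨
  sum (degree G)         ≡⟨ sum-cong-≗ (λ i → ≤-antisym (subst (degree G i ≤_) (proj₁ G∈) (degree≤maxDegree G i)) (degree≥ G G∈ i)) ⟩
  sum {2 + m} (λ _ → m)  ≡⟨ sum-const (2 + m) m ⟩
  (2 + m) * m            ∎
  where open ≡-Reasoning

-- Sizes are compared after doubling, the form in which the handshake identity delivers them.
e₃-intro : ∀ {n ℓ e k} → 2 * e ≡ k → Σ[ G ∈ Graph n ] (ℋ₃ n ℓ 2 G × 2 * size G ≡ k) →
           (∀ (G : Graph n) → ℋ₃ n ℓ 2 G → k ≤ 2 * size G) → e₃[ n , ℓ , 2 ]≡ [ e ]
e₃-intro {e = e} 2e≡k (G , G∈ , 2size≡k) k≤2size =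
  (G , G∈ , *-cancelˡ-≡ (size G) e 2 (trans 2size≡k (sym 2e≡k))) ,
  λ { _ (G′ , G′∈ , refl) → *-cancelˡ-≤ 2 (≤-trans (≤-reflexive 2e≡k) (k≤2size G′ G′∈)) }

theorem3p1 : ∀ (n : ℕ) → 3 ≤ n →
    ((2 ∤ n → e₃[ n , n ∸ 1 , 2 ]≡ [ (n C 2) ∸ (n ∸ 1) / 2 ]) ×
    (2 ∣ n → e₃[ n , n ∸ 1 , 2 ]≡ [ (n C 2) ∸ (n ∸ 2) / 2 ])) ×
    ((2 ∣ n → e₃[ n , n ∸ 2 , 2 ]≡ [ (n C 2) ∸ n / 2 ]) ×
    (2 ∤ n → e₃[ n , n ∸ 2 , 2 ]≡ ⊤⁺))
theorem3p1 (suc zero) (s≤s ())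
theorem3p1 (suc (suc m)) 3≤n = (odd-n-1 , even-n-1) , (even-n-2 , odd-n-2)
  where
  ring₁ : ∀ m → (2 + m) * (1 + m) ≡ (2 + m) * m + 1 + (1 + m)
  ring₁ = solve-∀
  ring₂ : ∀ m → (2 + m) * (1 + m) ≡ (2 + m) * m + 2 + m
  ring₂ = solve-∀
  ring₃ : ∀ m → (2 + m) * (1 + m) ≡ (2 + m) * m + (2 + m)
  ring₃ = solve-∀

  odd-n-1 : 2 ∤ 2 + m → e₃[ 2 + m , 1 + m , 2 ]≡ [ ((2 + m) C 2) ∸ (1 + m) / 2 ]
  -- For odd order the matching misses one vertex, and the bound `size-lower` is met exactly.
  odd-n-1 2∤n with q , n≡ ← odd 2∤n = e₃-intro
    (2*[nC2∸h/2] m (1 + m) (divides q (cong (_∸ 1) n≡)) (ring₁ m))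
    (extremal q 1 (trans n≡ (+-comm 1 (q * 2))) refl 3≤n (+-comm 1 m))
    (λ G G∈ → subst (_≤ 2 * size G) (+-comm 1 _) (size-lower G G∈))

  even-n-1 : 2 ∣ 2 + m → e₃[ 2 + m , 1 + m , 2 ]≡ [ ((2 + m) C 2) ∸ m / 2 ]
  -- Writing `m` as `q * 2` leaves two vertices outside a matching of `q` edges. Parity raises the
  -- strict lower bound by one more to match.
  even-n-1 2∣n with 2∣m@(divides q m≡) ← ∣m+n∣m⇒∣n 2∣n (∣-refl {2}) = e₃-intro
    (2*[nC2∸h/2] m m 2∣m (ring₂ m))
    (extremal q 2 (trans (cong (2 +_) m≡) (+-comm 2 (q * 2))) refl 3≤n (+-comm 1 m))
    (λ G G∈ → subst (_≤ 2 * size G) (+-comm 2 _) (≤∧≢⇒< (size-lower G G∈) (parity G)))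
    where
    parity : ∀ (G : Graph (2 + m)) → suc ((2 + m) * m) ≢ 2 * size G
    parity G eq = contradiction
      (∣m+n∣m⇒∣n (subst (2 ∣_) (trans (sym eq) (+-comm 1 _)) (m∣m*n (size G))) (∣m⇒∣m*n m 2∣n)) 2∤1
      where
      2∤1 : 2 ∤ 1
      2∤1 (divides zero ())
      2∤1 (divides (suc _) ())

  even-n-2 : 2 ∣ 2 + m → e₃[ 2 + m , m , 2 ]≡ [ ((2 + m) C 2) ∸ (2 + m) / 2 ]
  -- A perfect matching, `r = 0`, leaves an `m`-regular complement.
  even-n-2 2∣n@(divides q n≡) = e₃-intro
    (2*[nC2∸h/2] m (2 + m) 2∣n (trans (ring₃ m) (cong (_+ (2 + m)) (sym (+-identityʳ _)))))
    (extremal q 0 (trans n≡ (sym (+-identityʳ _))) refl 3≤n (sym (+-identityʳ m)))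
    (λ G G∈ → ≤-reflexive (trans (+-identityʳ _) (sym (size-regular G G∈))))

  odd-n-2 : 2 ∤ 2 + m → e₃[ 2 + m , m , 2 ]≡ ⊤⁺
  -- Regularity would make `(2 + m) * m` even, so 2 would divide one of the factors and, as they
  -- differ by 2, the order.
  odd-n-2 2∤n _ (G , G∈ , _) =
    [ 2∤n , 2∤n ∘ ∣m∣n⇒∣m+n ∣-refl ]′
      (euclidsLemma (2 + m) m prime[2] (subst (2 ∣_) (size-regular G G∈) (m∣m*n (size G))))
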